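{- There exist a carrier kind, a declared regime $\tau$ for it with sibling $\tau'=\mathrm{Sib}(\tau)$, a finite record domain $R$ of that kind with a family-labeled history $H$ over $R$ using the imported transformation families, and an audit surface $d$ over $R$, such that there is a divergence witness $(r,s)$ for $(d,\tau)$ with $r\not\sim_{\tau'}s$, and yet $d$ exhibits sub-sibling divergence rather than sibling-aligned divergence.
   Context: Regimes and declared identity. $\mathcal{F}$ is a finite set of transformation families. An identity regime $\rho$ carries a classification function $\mathrm{Class}_\rho:\mathcal{F}\to\{\mathsf{PRS},\mathsf{BRK},\mathsf{NEU},\mathsf{N/A}\}$ (preserving, breaking, neutral, not applicable). A history over $R$ is a finite sequence $H=\langle(f_i,x_i,y_i)\rangle_{i=1}^n$ with $f_i\in\mathcal{F}$, $x_i,y_i\in R$, and $\mathrm{Class}_\rho(f_i)\ne\mathsf{N/A}$ for every regime $\rho$ assigned to the carrier kind of $R$. Put $E_\rho=\{(x_i,y_i)\mid \mathrm{Class}_\rho(f_i)\in\{\mathsf{PRS},\mathsf{NEU}\}\}$; $\sim_\rho$ is the equivalence relation on $R$ generated by $E_\rho$, and $\pi_\rho=R/\!\sim_\rho$. Imported interface. The set $\mathcal{F}$, a finite inventory of nine regimes, their classification functions and the sibling function are fixed in advance. Sibling axes pair two regimes for one carrier kind: $\{\mathrm{LOC},\mathrm{OBJ}\}$ (plain referents: locus-fixed / object-fixed), $\{\mathrm{SCOPE\text{ - }E},\mathrm{SCOPE\text{ - }S}\}$ (scopes: extension-fixed / structure-fixed), $\{\mathrm{RULE\text{ - }C},\mathrm{RULE\text{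 - }S}\}$ (rules: content-fixed / structure-fixed). $\mathrm{Sib}(\tau)=\tau'$ if $\{\tau,\tau'\}$ is an axis, and $\mathrm{Sib}(\tau)=\varnothing$ if $\tau$ is on no axis. For the carrier kind of rules the interface includes families with: refine-structure is $\mathsf{PRS}$ under RULE-C and $\mathsf{BRK}$ under RULE-S; revise-wording (content- and structure-preserving rewording) is $\mathsf{PRS}$ under both; amend-content (changing content, preserving section structure) is $\mathsf{BRK}$ under RULE-C and $\mathsf{PRS}$ under RULE-S. For plain referents, branch/fork is $\mathsf{PRS}$ under LOC and $\mathsf{BRK}$ under OBJ. Surfaces. A mechanism registry $D_B$ is a finite set of artifacts $d$, each with a total computable map $d:R\to V_d$. For nonempty finite $S\subseteq D_B$ the joint mechanism is $d_S(r)=\langle d(r)\mid d\in S\rangle$; $\mathcal{D}_B$ is the set of joint mechanisms. An audit surface over $R$ is a mechanism $d\in\mathcal{D}_B$ with a finite sequence $U_d=\langle u_1,\dots,u_m\rangle$ of computable identity-relevant uses $u_j:R\to O_j$ (outcome functions of designated types such as referent-identifier assignment), each of the form $u_j=\tilde u_j\circ d$ on $R$ for some $\tilde u_j:V_d\to O_j$. Registry and surface may be chosen freely. $\mathsf{IT}_d(r)=\langle u_1(r),\dots,u_m(r)\rangle$; $r\approx_d s$ iff $\mathsf{IT}_d(r)=\mathsf{IT}_d(s)$. Classification. $d$ is faithful to $\tau$ on $R$ when $r\sim_\tau s\Rightarrow r\approx_d s$ for all $r,s\in R$. A divergence witness for $(d,\tau)$ is a pair $(r,s)\in R\times R$ with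 $r\sim_\tau s$ and $\mathsf{IT}_d(r)\ne\mathsf{IT}_d(s)$. With $\tau'=\mathrm{Sib}(\tau)\ne\varnothing$ put $\Delta^{\mathrm{op}}_d=\;\approx_d\cap\sim_\tau$ and $\Delta^{\mathrm{sib}}=\;\sim_{\tau'}\cap\sim_\tau$. Suppose $d$ is not faithful to $\tau$ on $R$, $\mathrm{Sib}(\tau)=\tau'\neq\varnothing$ and $\Delta^{\mathrm{sib}}\neq\;\sim_\tau$. Then $d$ exhibits sibling-aligned divergence when $\Delta^{\mathrm{op}}_d=\Delta^{\mathrm{sib}}$, and sub-sibling divergence when $\Delta^{\mathrm{op}}_d\subsetneq\Delta^{\mathrm{sib}}$. -}

module Defs where

open import Data.Fin using (Fin)
open import Data.Fin.Subset using (Subset; Nonempty)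
open import Data.Fin.Subset.Properties using (_∈?_)
open import Data.List using (List; allFin; filter)
open import Data.List.Relation.Unary.All using (All; universal)
open import Data.List.Relation.Unary.Any using (Any)
open import Data.Maybe using (Maybe; just; nothing)
open import Data.Nat using (ℕ; zero; suc; _<_)
open import Data.Product using (Σ; ∃; ∃-syntax; _×_)
open import Data.Sum using (_⊎_)
open import Data.Vec using (Vec; []; _∷_; lookup)
open import Function.Bundles using (_↔_; _↣_; Injection)
open import Level using (0ℓ) renaming (suc to lsuc)
open import Relation.Binary.Construct.Closure.Equivalence using (EqClosure)
open import Relation.Binary.Construct.Intersection using (_∩_)
open import Relation.Binary.Core using (Rel; _⇒_; _⇔_)
open import Relation.Binary.PropositionalEquality using (_≡_; _≢_)
open import Relation.Nullary using (¬_)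

Finite : Set → Set
Finite A = ∃[ n ] (A ↔ Fin n)

_⊊_ : ∀ {A : Set} {ℓ₁ ℓ₂} → Rel A ℓ₁ → Rel A ℓ₂ → Set _
P ⊊ Q = (P ⇒ Q) × ¬ (P ⇔ Q)

infix 4 _⊊_

-- Computability is made explicit through partial recursive functions, so
-- that "computable" is a condition even on maps that depend on abstract
-- parameters.

data Code : ℕ → Set where
  zeroᶜ : ∀ {n} → Code n
  sucᶜ  : Code 1
  projᶜ : ∀ {n} → Fin n → Code n
  compᶜ : ∀ {m n} → Code m → Vec (Code n) m → Code n
  recᶜ  : ∀ {n} → Code n → Code (suc (suc n)) → Code (suc n)
  minᶜ  : ∀ {n} → Code (suc n) → Code n

infix 4 _[_]⇓_ _[_]⇓*_

mutual
  data _[_]⇓_ : ∀ {n} → Code n → Vec ℕ n → ℕ → Set where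
    ⇓zero : ∀ {n} {xs : Vec ℕ n} → zeroᶜ [ xs ]⇓ 0
    ⇓suc  : ∀ {x} → sucᶜ [ x ∷ [] ]⇓ suc x
    ⇓proj : ∀ {n} {xs : Vec ℕ n} (i : Fin n) → projᶜ i [ xs ]⇓ lookup xs i
    ⇓comp : ∀ {m n} {f : Code m} {gs : Vec (Code n) m} {xs ys y} →
            gs [ xs ]⇓* ys → f [ ys ]⇓ y → compᶜ f gs [ xs ]⇓ y
    ⇓rec₀ : ∀ {n} {f : Code n} {g xs y} →
            f [ xs ]⇓ y → recᶜ f g [ 0 ∷ xs ]⇓ y
    ⇓recₛ : ∀ {n} {f : Code n} {g x xs y z} →
            recᶜ f g [ x ∷ xs ]⇓ y → g [ y ∷ x ∷ xs ]⇓ z →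
            recᶜ f g [ suc x ∷ xs ]⇓ z
    ⇓min  : ∀ {n} {f : Code (suc n)} {xs y} →
            (∀ x → x < y → ∃[ z ] f [ x ∷ xs ]⇓ suc z) →
            f [ y ∷ xs ]⇓ 0 → minᶜ f [ xs ]⇓ y

  data _[_]⇓*_ {n} : ∀ {m} → Vec (Code n) m → Vec ℕ n → Vec ℕ m → Set where
    []  : ∀ {xs} → [] [ xs ]⇓* []
    _∷_ : ∀ {m} {g : Code n} {gs : Vec (Code n) m} {xs y ys} →
          g [ xs ]⇓ y → gs [ xs ]⇓* ys → (g ∷ gs) [ xs ]⇓* (y ∷ ys)

-- Carriers are encodable in ℕ. For a map on a finite domain, computability does
-- not depend on the chosen encodings.
record DataType : Set₁ where
  field
    Carrier  : Set
    encoding : Carrier ↣ ℕ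

  encode : Carrier → ℕ
  encode = Injection.to encoding

open DataType using (encode) renaming (Carrier to ∣_∣)

Computable : (A B : DataType) → (∣ A ∣ → ∣ B ∣) → Set
Computable A B f =
  ∃[ c ] (∀ a → c [ encode A a ∷ [] ]⇓ encode B (f a))

-- Preserving, breaking, neutral, not applicable.
data Classification : Set where
  PRS BRK NEU N/A : Classification

-- Nine regimes, of which six lie on a sibling axis; the names of the
-- remaining three are immaterial.
data Regime : Set where
  LOC OBJ SCOPE-E SCOPE-S RULE-C RULE-S : Regime
  off-axis : Fin 3 → Regime

Sib : Regime → Maybe Regime
Sib LOC          = just OBJ
Sib OBJ          = just LOC
Sib SCOPE-E      = just SCOPE-S
Sib SCOPE-S      = just SCOPE-E
Sib RULE-C       = just RULE-S
Sib RULE-S       = just RULE-C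
Sib (off-axis _) = nothing

data Kind (OtherKind : Set) : Set where
  plain-referent scope rule : Kind OtherKind
  other : OtherKind → Kind OtherKind

record Interface : Set₁ where
  field
    OtherKind : Set

    -- ρ For k: the regime ρ is assigned to the carrier kind k.
    _For_       : Regime → Kind OtherKind → Set
    LOC-For     : LOC For plain-referent
    OBJ-For     : OBJ For plain-referent
    SCOPE-E-For : SCOPE-E For scope
    SCOPE-S-For : SCOPE-S For scope
    RULE-C-For  : RULE-C For rule
    RULE-S-For  : RULE-S For rule

    Family        : Set
    Family-finite : Finite Family
    Class         : Regime → Family → Classification

  CarrierKind : Set
  CarrierKind = Kind OtherKind

  Applicable : Family → CarrierKind → Set
  Applicable f k = ∀ ρ → ρ For k → Class ρ f ≢ N/A

  -- A family available "for" a carrier kind is applicable to that kind, so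
  -- that it may occur in histories over domains of the kind.
  field
    refine-structure            : Family
    refine-structure-applicable : Applicable refine-structure rule
    refine-structure-RULE-C     : Class RULE-C refine-structure ≡ PRS
    refine-structure-RULE-S     : Class RULE-S refine-structure ≡ BRK

    revise-wording            : Family
    revise-wording-applicable : Applicable revise-wording rule
    revise-wording-RULE-C     : Class RULE-C revise-wording ≡ PRS
    revise-wording-RULE-S     : Class RULE-S revise-wording ≡ PRS

    amend-content            : Family
    amend-content-applicable : Applicable amend-content rule
    amend-content-RULE-C     : Class RULE-C amend-content ≡ BRK
    amend-content-RULE-S     : Class RULE-S amend-content ≡ PRS

    branch/fork            : Family
    branch/fork-applicable : Applicable branch/fork plain-referent
    branch/fork-LOC        : Class LOC branch/fork ≡ PRS
    branch/fork-OBJ        : Class OBJ branch/fork ≡ BRK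

    -- The designated types of identity-relevant use. A designation does not
    -- restrict the set in which the outcomes are recorded.
    UseType                        : Set
    referent-identifier-assignment : UseType

module Theory (I : Interface) where

  open Interface I public

  -- The kind enters only through the regimes assigned to it.
  record RecordDomain (k : CarrierKind) : Set₁ where
    field
      records : DataType

    Record : Set
    Record = ∣ records ∣

  module _ {k : CarrierKind} (R : RecordDomain k) where

    open RecordDomain R

    record Step : Set where
      field
        family     : Family
        before     : Record
        after      : Record
        applicable : Applicable family k

    History : Set
    History = List Step

    -- Artifacts are numbered by Fin size.
    record Registry : Set₁ where
      field
        size           : ℕ
        Value          : Fin size → DataType
        map            : ∀ a → Record → ∣ Value a ∣
        map-computable : ∀ a → Computable records (Value a) (map a)

      members : Subset size → List (Fin size)
      members S = filter (_∈? S) (allFin size)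

      -- Tuples are first-order data (All over a list) rather than dependent
      -- functions, so that ≡ on them is componentwise without extensionality.
      JointValue : Subset size → Set
      JointValue S = All (λ a → ∣ Value a ∣) (members S)

      joint : (S : Subset size) → Record → JointValue S
      joint S r = universal (λ a → map a r) (members S)

    record Use {V : Set} (d : Record → V) : Set₁ where
      field
        type       : UseType
        Outcome    : DataType
        use        : Record → ∣ Outcome ∣
        computable : Computable records Outcome use
        factors    : Σ (V → ∣ Outcome ∣) λ ũ → ∀ r → use r ≡ ũ (d r)

    record AuditSurface : Set₁ where
      field
        registry : Registry
      open Registry registry public
      field
        S          : Subset size
        S-nonempty : Nonempty S
        uses       : List (Use (joint S))

      IT : Record → All (λ u → ∣ Use.Outcome u ∣) uses
      IT r = universal (λ u → Use.use u r) uses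

      _≈_ : Rel Record (lsuc 0ℓ)
      r ≈ s = IT r ≡ IT s

  module _ {k : CarrierKind} {R : RecordDomain k} where

    open RecordDomain R

    E : History R → Regime → Rel Record 0ℓ
    E H ρ x y = Any Generates H
      where
      Generates : Step R → Set
      Generates h = (Class ρ family ≡ PRS ⊎ Class ρ family ≡ NEU)
                  × before ≡ x × after ≡ y
        where open Step h

    Same : History R → Regime → Rel Record 0ℓ
    Same H ρ = EqClosure (E H ρ)

    syntax Same H ρ r s = r ∼[ H , ρ ] s

    module _ (H : History R) (d : AuditSurface R) where

      open AuditSurface d using (IT; _≈_)

      Faithful : Regime → Set₁
      Faithful τ = ∀ r s → r ∼[ H , τ ] s → r ≈ s

      DivergenceWitness : Regime → Record → Record → Set₁
      DivergenceWitness τ r s = r ∼[ H , τ ] s × IT r ≢ IT s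

      Δop : Regime → Rel Record (lsuc 0ℓ)
      Δop τ = _≈_ ∩ Same H τ

      Δsib : (τ τ′ : Regime) → Rel Record 0ℓ
      Δsib τ τ′ = Same H τ′ ∩ Same H τ

      Comparable : (τ τ′ : Regime) → Set₁
      Comparable τ τ′ = ¬ Faithful τ
                      × Sib τ ≡ just τ′
                      × ¬ (Δsib τ τ′ ⇔ Same H τ)

      SiblingAligned : Regime → Set₁
      SiblingAligned τ = ∃[ τ′ ] Comparable τ τ′ × (Δop τ ⇔ Δsib τ τ′)

      SubSibling : Regime → Set₁
      SubSibling τ = ∃[ τ′ ] Comparable τ τ′ × (Δop τ ⊊ Δsib τ τ′)

-- Take three rules r₀, r₁, r₂ with refine-structure r₀ → r₁ and
-- revise-wording r₁ → r₂. All three are identified under RULE-C, while RULE-S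
-- separates r₀ from r₁ and r₂. A surface that assigns distinct identifiers to
-- all records separates (r₀ , r₁), as RULE-S does, but also (r₁ , r₂), which
-- RULE-S identifies: it is strictly finer than the sibling regime.
module Submission where

open import Defs
open import Data.Fin using (Fin; zero; suc)
open import Data.Fin.Properties using (toℕ-injective)
open import Data.Fin.Subset using (⊤)
open import Data.Fin.Subset.Properties using (∈⊤)
open import Data.List using ([]; _∷_)
open import Data.List.Relation.Unary.All using (head)
open import Data.List.Relation.Unary.Any using (here; there)
open import Data.Maybe using (just)
open import Data.Maybe.Properties using (just-injective)
open import Data.Nat using (ℕ)
open import Data.Product using (∃-syntax; Σ-syntax; _×_; _,_; proj₁)
open import Data.Sum using (_⊎_; inj₁; inj₂)
open import Function using (_on_)
open import Function.Bundles using (mk↣)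
open import Function.Construct.Identity using (↔-id)
open import Relation.Binary.Construct.Closure.Equivalence using (fold; reflexive; return)
import Relation.Binary.Construct.On as On
open import Relation.Binary.Core using (_⇒_)
open import Relation.Binary.PropositionalEquality
  using (_≡_; _≢_; refl; sym; trans; cong; isEquivalence)
open import Relation.Nullary using (¬_; contradiction)

id-computable : ∀ A → Computable A A (λ a → a)
id-computable A = projᶜ zero , λ a → ⇓proj zero

finData : ℕ → DataType
finData n = record { Carrier = Fin n ; encoding = mk↣ toℕ-injective }

BRK-not-preserving : ∀ {c} → c ≡ BRK → ¬ (c ≡ PRS ⊎ c ≡ NEU)
BRK-not-preserving refl (inj₁ ())
BRK-not-preserving refl (inj₂ ())

module _ (I : Interface) where

  open Theory I

  module _ {k : CarrierKind} {R : RecordDomain k} where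

    -- Each hypothesis supplies its own sibling regime. `Sib` is a function, so the two coincide,
    -- and strictness of the inclusion then contradicts equality.
    subSibling⇒¬siblingAligned : (H : History R) (d : AuditSurface R) {τ : Regime} →
                                 SubSibling H d τ → ¬ SiblingAligned H d τ
    subSibling⇒¬siblingAligned H d
      (_ , (_ , sib₁ , _) , _ , Δop≠Δsib) (_ , (_ , sib₂ , _) , Δop⇔Δsib)
      with refl ← just-injective (trans (sym sib₁) sib₂) = Δop≠Δsib Δop⇔Δsib

  module _ {k : CarrierKind} (R : RecordDomain k) where

    open RecordDomain R

    -- The finest surface possible: its single artifact and its single use are both the identity, so
    -- `_≈_` is equality of records.
    identitySurface : AuditSurface R
    identitySurface = record
      { registry = record
        { size           = 1
        ; Value          = λ _ → records
        ; map            = λ _ r → r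
        ; map-computable = λ _ → id-computable records
        }
      ; S          = ⊤
      ; S-nonempty = zero , ∈⊤
      ; uses       = record
        { type       = referent-identifier-assignment
        ; Outcome    = records
        ; use        = λ r → r
        ; computable = id-computable records
        -- The joint value is a tuple with one entry, the record itself.
        ; factors    = head , λ _ → refl
        } ∷ []
      }

    IT-injective : ∀ {r s} →
                   AuditSurface.IT identitySurface r ≡ AuditSurface.IT identitySurface s → r ≡ s
    IT-injective = cong head

  rules : RecordDomain rule
  rules = record { records = finData 3 }

  pattern r₀ = zero
  pattern r₁ = suc zero
  pattern r₂ = suc (suc zero)

  history : History rules
  history =
      record { family = refine-structure ; before = r₀ ; after = r₁
             ; applicable = refine-structure-applicable }
    ∷ record { family = revise-wording ; before = r₁ ; after = r₂
             ; applicable = revise-wording-applicable }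
    ∷ []

  surface : AuditSurface rules
  surface = identitySurface rules

  r₀∼r₁ : r₀ ∼[ history , RULE-C ] r₁
  r₀∼r₁ = return (here (inj₁ refine-structure-RULE-C , refl , refl))

  -- Kept general in `ρ` because membership in `Δsib` needs this pair under both RULE-C and RULE-S.
  r₁∼r₂ : ∀ {ρ} → Class ρ revise-wording ≡ PRS → r₁ ∼[ history , ρ ] r₂
  r₁∼r₂ prs = return (there (here (inj₁ prs , refl , refl)))

  structure : Fin 3 → Fin 2
  structure r₀ = zero
  structure (suc _) = suc zero

  -- The kernel of `structure` is an equivalence relation, so it contains the generated one as soon
  -- as it contains the edges. The refining step gives no edge under RULE-S, and the rewording stays
  -- within one fibre.
  structure-invariant : Same {R = rules} history RULE-S ⇒ (_≡_ on structure)
  structure-invariant = fold (On.isEquivalence structure isEquivalence) step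
    where
    step : E {R = rules} history RULE-S ⇒ (_≡_ on structure)
    step (here (preserving , _)) =
      contradiction preserving (BRK-not-preserving refine-structure-RULE-S)
    step (there (here (_ , refl , refl))) = refl

  r₀≁r₁ : ¬ (r₀ ∼[ history , RULE-S ] r₁)
  r₀≁r₁ r₀∼r₁ with () ← structure-invariant r₀∼r₁

  IT-separates : ∀ {r s} → r ≢ s → AuditSurface.IT surface r ≢ AuditSurface.IT surface s
  IT-separates r≢s IT≡ = r≢s (IT-injective rules IT≡)

  subSibling : SubSibling history surface RULE-C
  subSibling = RULE-S , (not-faithful , refl , Δsib≠∼) , Δop⇒Δsib , Δop≠Δsib
    where
    not-faithful : ¬ Faithful history surface RULE-C
    not-faithful faithful = IT-separates (λ ()) (faithful r₀ r₁ r₀∼r₁)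

    -- The sibling regime splits a RULE-C class at `r₀`, `r₁`.
    Δsib≠∼ = λ (_ , ∼⇒Δsib) → r₀≁r₁ (proj₁ (∼⇒Δsib r₀∼r₁))

    Δop⇒Δsib : Δop history surface RULE-C ⇒ Δsib history surface RULE-C RULE-S
    -- `Δop` lies on the diagonal, where reflexivity suffices.
    Δop⇒Δsib (r≈s , r∼s) with refl ← IT-injective rules r≈s = reflexive _ , r∼s

    -- The pair `r₁`, `r₂` makes the inclusion strict: the rewording preserves identity under both
    -- regimes, yet the surface tells the two records apart.
    Δop≠Δsib = λ (_ , Δsib⇒Δop) →
      IT-separates (λ ()) (proj₁ (Δsib⇒Δop
        (r₁∼r₂ revise-wording-RULE-S , r₁∼r₂ revise-wording-RULE-C)))

proposition4p15 : (I : Interface) → let open Theory I in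
    Σ[ k ∈ CarrierKind ] Σ[ τ ∈ Regime ] Σ[ τ′ ∈ Regime ]
    τ For k × Sib τ ≡ just τ′ ×
    (Σ[ R ∈ RecordDomain k ] Finite (RecordDomain.Record R) ×
    (Σ[ H ∈ History R ] Σ[ d ∈ AuditSurface R ]
    (∃[ r ] ∃[ s ] DivergenceWitness H d τ r s × ¬ (r ∼[ H , τ′ ] s))
    × SubSibling H d τ
    × ¬ SiblingAligned H d τ))
proposition4p15 I =
  rule , RULE-C , RULE-S , Interface.RULE-C-For I , refl ,
  rules I , (3 , ↔-id _) , history I , surface I ,
  (r₀ , r₁ , (r₀∼r₁ I , IT-separates I (λ ())) , r₀≁r₁ I) ,
  subSibling I ,
  subSibling⇒¬siblingAligned I (history I) (surface I) (subSibling I)
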